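{- Let $G$ be a finite simple graph on $d$ vertices, with chromatic polynomial $\chi_G(n)$, and let $h_G(z)$ be the polynomial such that $$\sum_{n=0}^{\infty} \chi_G(n) z^n = \frac{h_G(z)}{(1-z)^{d+1}}.$$ Then the polynomial $z h_G(z)$ can be decomposed as $z h_G(z) = a(z) + z\, b(z)$, where $a$ and $b$ are polynomials satisfying $a(z) = z^{d+1} a\left(\frac{1}{z}\right)$ and $b(z) = z^{d} b\left(\frac{1}{z}\right)$, and such that $b(z)$ and $-a(z)$ have nonnegative coefficients.
   Context: The chromatic polynomial $\chi_G(n)$ counts the maps $\phi: V \to \{1, \ldots, n\}$ on the vertex set $V$ of $G$ such that $\phi(v) \ne \phi(w)$ whenever $vw$ is an edge of $G$. -}

module Defs where

open import Data.Fin.Base using (Fin; toℕ; finToFun)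
open import Data.Fin.Properties using (all?) renaming (_≟_ to _≟ᶠ_)
open import Data.Integer.Base using (ℤ; +_; -[1+_]; -_; _+_; _-_; _*_; _≤_; 0ℤ; 1ℤ; -1ℤ)
open import Data.Integer.Properties using (+-0-monoid)
open import Data.List.Base using (List; []; _∷_; map; length; filter; allFin)
open import Data.Nat.Base using (ℕ; zero; suc; _∸_; _^_)
open import Level using (0ℓ)
open import Relation.Binary.Core using (Rel)
open import Relation.Binary.Definitions using (Decidable; Symmetric; Irreflexive)
open import Relation.Binary.PropositionalEquality.Core using (_≡_; _≢_)
open import Relation.Nullary.Decidable using (Dec; ¬?; _→-dec_)
open import Algebra.Properties.Monoid.Sum +-0-monoid using (sum⁺-syntax)

record SimpleGraph (d : ℕ) : Set₁ where
  field
    Adj    : Rel (Fin d) 0ℓ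
    adj?   : Decidable Adj
    sym    : Symmetric Adj
    irrefl : Irreflexive _≡_ Adj

module _ {d : ℕ} (G : SimpleGraph d) where
  open SimpleGraph G

  Proper : {n : ℕ} → (Fin d → Fin n) → Set
  Proper φ = ∀ v w → Adj v w → φ v ≢ φ w

  proper? : {n : ℕ} (φ : Fin d → Fin n) → Dec (Proper φ)
  proper? φ = all? λ v → all? λ w → adj? v w →-dec ¬? (φ v ≟ᶠ φ w)

  -- finToFun is a bijection (up to pointwise equality) from Fin (n ^ d) onto
  -- the maps Fin d → Fin n, so each proper map is counted exactly once.
  χ : ℕ → ℕ
  χ n = length (filter (λ i → proper? (finToFun {n} {d} i)) (allFin (n ^ d)))

-- Coefficient lists, constant term first.  Trailing zeros are allowed, so
-- equality of polynomials is _≈ₚ_ rather than _≡_.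
Poly : Set
Poly = List ℤ

coeff : Poly → ℕ → ℤ
coeff []      _       = 0ℤ
coeff (c ∷ _) zero    = c
coeff (_ ∷ p) (suc i) = coeff p i

infix  4 _≈ₚ_
infixl 6 _+ₚ_
infixr 7 z·_
infix  8 -ₚ_

_≈ₚ_ : Poly → Poly → Set
p ≈ₚ q = ∀ i → coeff p i ≡ coeff q i

_+ₚ_ : Poly → Poly → Poly
[]      +ₚ q       = q
(c ∷ p) +ₚ []      = c ∷ p
(c ∷ p) +ₚ (e ∷ q) = c + e ∷ p +ₚ q

-ₚ_ : Poly → Poly
-ₚ p = map -_ p

z·_ : Poly → Poly
z· p = 0ℤ ∷ p

NonNegative : Poly → Set
NonNegative p = ∀ i → 0ℤ ≤ coeff p i

-- Formal power series over ℤ, as coefficient sequences.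
Series : Set
Series = ℕ → ℤ

infixl 7 _⊛_

_⊛_ : Series → Series → Series
(f ⊛ g) n = ∑[ i ≤ n ] (f (toℕ i) * g (n ∸ toℕ i))

pow : Series → ℕ → Series
pow f zero    = coeff (1ℤ ∷ [])
pow f (suc k) = f ⊛ pow f k

1-z : Series
1-z = coeff (1ℤ ∷ -1ℤ ∷ [])

-- ∑ₙ χ_G(n) zⁿ = h(z) / (1 - z)^(d+1), read in ℤ[[z]], where 1 - z is a unit.
IsHPolynomial : {d : ℕ} → SimpleGraph d → Poly → Set
IsHPolynomial {d} G h =
  ∀ n → (pow 1-z (suc d) ⊛ (λ m → + χ G m)) n ≡ coeff h n

-- Doubly infinite coefficient sequences; they contain the Laurent polynomials,
-- in particular zᵐ p(1/z), which need not be a polynomial.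
Laurent : Set
Laurent = ℤ → ℤ

laurent : Poly → Laurent
laurent p (+ i)    = coeff p i
laurent p -[1+ _ ] = 0ℤ

invert : Laurent → Laurent
invert f k = f (- k)

z^_·_ : ℕ → Laurent → Laurent
(z^ m · f) k = f (k - + m)

-- p(z) = zᵐ p(1/z)
Palindromic : ℕ → Poly → Set
Palindromic m p = ∀ k → laurent p k ≡ (z^ m · invert (laurent p)) k

{-# OPTIONS --safe #-}

-- Write h_f = (1 - z)ᵈ⁺¹ Σ f(n) zⁿ for f counting maps out of d vertices.  By deletion–contraction
-- h_G = h_{G-e} - (1 - z) c with c = h_{G/e}, so a decomposition of z h_{G-e} yields the
-- decomposition a - z (c* + c), b + (c* + z c) of z h_G, where c*(z) = zᵈ⁻¹ c(1/z).  Without edges,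
-- h is the Eulerian polynomial, which is palindromic, and z h = -h + z (h + h/z).
--
-- It remains to see that h_G has nonnegative coefficients.  Splitting each condition φ u ≠ φ v
-- into φ u < φ v and φ v < φ u reduces this to strictly increasing maps on an acyclic digraph.
-- There, raising the bound on φ from n to n + 1 one vertex at a time, in an order where heads of
-- arcs precede tails, adds at each vertex v the maps with φ v = n: none unless v is a sink, and
-- otherwise those of the digraph without v.
module Submission where

open import Data.Fin.Base
  using (Fin; zero; suc; toℕ; punchIn; punchOut; combine; finToFun; _↑ˡ_; _↑ʳ_)
import Data.Fin.Properties as Fin
open import Data.Integer.Base
  using (ℤ; +_; -[1+_]; -_; _+_; _-_; _*_; _≤_; 0ℤ; 1ℤ; -1ℤ; +≤+)
import Data.Integer.Properties as ℤ
open import Data.Integer.Tactic.RingSolver using (solve-∀)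
open import Data.List.Base
  using (List; []; _∷_; applyUpTo; map; filter; length; tabulate; allFin; cartesianProduct)
open import Data.List.Membership.Propositional using (_∈_)
open import Data.List.Membership.Propositional.Properties
  using (∈-filter⁺; ∈-filter⁻; ∈-cartesianProduct⁺; ∈-allFin)
import Data.List.Membership.DecPropositional as DecMembership
open import Data.List.Relation.Unary.All as All using (All; []; _∷_)
import Data.List.Relation.Unary.All.Properties as All
open import Data.Nat.Base as ℕ using (ℕ; zero; suc; _∸_; z≤n; s≤s)
import Data.Nat.DivMod as ℕ
import Data.Nat.Properties as ℕ
open import Data.Product.Base as Product using (_×_; _,_; proj₁; proj₂; ∃; ∃₂)
open import Data.Product.Properties using (≡-dec)
open import Data.Sum.Base using (_⊎_; inj₁; inj₂)
open import Data.Vec.Base using (Vec; []; _∷_; lookup; insertAt)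
open import Data.Vec.Properties using (insertAt-lookup; insertAt-punchIn)
open import Function.Base using (_∘_; const; id)
open import Level using (0ℓ)
open import Relation.Binary.Core using (Rel)
open import Relation.Binary.Definitions using (Decidable; tri<; tri≈; tri>)
open import Relation.Binary.PropositionalEquality
open import Relation.Nullary.Decidable
  using (Dec; yes; no; decidable-stable; _→-dec_; _×-dec_; ¬?)
open import Relation.Nullary.Negation using (¬_; contradiction)
open import Relation.Unary as Unary using (Pred)
open import Algebra.Properties.CommutativeMonoid.Sum ℤ.+-0-commutativeMonoid
open import Defs

-- Power series and backward differences

infixl 6 _⊕_ _⊖_

_⊕_ _⊖_ : Series → Series → Series
(f ⊕ g) n = f n + g n
(f ⊖ g) n = f n - g n

0ₛ : Series
0ₛ _ = 0ℤ

shift : Series → Series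
shift f zero    = 0ℤ
shift f (suc n) = f n

-- On generating functions this is multiplication by 1 - z, so `∇^ (suc d) f` is the numerator of Σ
-- f(n) zⁿ over (1 - z)ᵈ⁺¹.
∇ : Series → Series
∇ f = f ⊖ shift f

∇^ : ℕ → Series → Series
∇^ zero    f = f
∇^ (suc k) f = ∇ (∇^ k f)

shift-cong : ∀ {f g} → f ≗ g → shift f ≗ shift g
shift-cong f≗g zero    = refl
shift-cong f≗g (suc n) = f≗g n

∇-cong : ∀ {f g} → f ≗ g → ∇ f ≗ ∇ g
∇-cong f≗g n = cong₂ _-_ (f≗g n) (shift-cong f≗g n)

∇^-cong : ∀ k {f g} → f ≗ g → ∇^ k f ≗ ∇^ k g
∇^-cong zero    f≗g = f≗g
∇^-cong (suc k) f≗g = ∇-cong (∇^-cong k f≗g)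

shift-⊕ : ∀ f g → shift (f ⊕ g) ≗ shift f ⊕ shift g
shift-⊕ f g zero    = refl
shift-⊕ f g (suc n) = refl

shift-⊖ : ∀ f g → shift (f ⊖ g) ≗ shift f ⊖ shift g
shift-⊖ f g zero    = refl
shift-⊖ f g (suc n) = refl

∇-⊕ : ∀ f g → ∇ (f ⊕ g) ≗ ∇ f ⊕ ∇ g
∇-⊕ f g n = trans (cong (λ s → f n + g n - s) (shift-⊕ f g n)) (interchange (f n) (g n) _ _)
  where
  interchange : ∀ a b c d → a + b - (c + d) ≡ a - c + (b - d)
  interchange = solve-∀

∇-⊖ : ∀ f g → ∇ (f ⊖ g) ≗ ∇ f ⊖ ∇ g
∇-⊖ f g n = trans (cong (λ s → f n - g n - s) (shift-⊖ f g n)) (interchange (f n) (g n) _ _)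
  where
  interchange : ∀ a b c d → a - b - (c - d) ≡ a - c - (b - d)
  interchange = solve-∀

∇^-⊕ : ∀ k f g → ∇^ k (f ⊕ g) ≗ ∇^ k f ⊕ ∇^ k g
∇^-⊕ zero    f g n = refl
∇^-⊕ (suc k) f g n = trans (∇-cong (∇^-⊕ k f g) n) (∇-⊕ (∇^ k f) (∇^ k g) n)

∇^-⊖ : ∀ k f g → ∇^ k (f ⊖ g) ≗ ∇^ k f ⊖ ∇^ k g
∇^-⊖ zero    f g n = refl
∇^-⊖ (suc k) f g n = trans (∇-cong (∇^-⊖ k f g) n) (∇-⊖ (∇^ k f) (∇^ k g) n)

∇^-0 : ∀ k {f} → f ≗ 0ₛ → ∇^ k f ≗ 0ₛ
∇^-0 zero    f≗0 n = f≗0 n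
∇^-0 (suc k) f≗0 zero = cong (_- 0ℤ) (∇^-0 k f≗0 zero)
∇^-0 (suc k) f≗0 (suc n) = cong₂ _-_ (∇^-0 k f≗0 (suc n)) (∇^-0 k f≗0 n)

∇-shift : ∀ f → ∇ (shift f) ≗ shift (∇ f)
∇-shift f zero    = refl
∇-shift f (suc n) = refl

∇^-shift : ∀ k f → ∇^ k (shift f) ≗ shift (∇^ k f)
∇^-shift zero    f n = refl
∇^-shift (suc k) f n = trans (∇-cong (∇^-shift k f) n) (∇-shift _ n)

∇^-∇ : ∀ k f → ∇^ k (∇ f) ≗ ∇^ (suc k) f
∇^-∇ zero    f n = refl
∇^-∇ (suc k) f n = ∇-cong (∇^-∇ k f) n

-- The operator z d/dz on generating functions.
scale : Series → Series
scale f n = + n * f n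

-- (1 - z)ᵏ (z F′) = z ((1 - z)ᵏ F)′ + k z (1 - z)ᵏ⁻¹ F.
∇^-scale : ∀ k f n → ∇^ (suc k) (scale f) n ≡
           scale (∇^ (suc k) f) n + + suc k * shift (∇^ k f) n
∇^-scale zero f zero    = refl
∇^-scale zero f (suc n) = trans (cong (λ m → m * f (suc n) - + n * f n) (ℤ.pos-+ 1 n))
  (trans (expand (+ n) (f (suc n)) (f n))
    (cong (λ m → m * (f (suc n) - f n) + 1ℤ * f n) (sym (ℤ.pos-+ 1 n))))
  where
  expand : ∀ m a b → (1ℤ + m) * a - m * b ≡ (1ℤ + m) * (a - b) + 1ℤ * b
  expand = solve-∀
∇^-scale (suc k) f zero    =
  trans (cong (_- 0ℤ) (∇^-scale k f zero))
    (zeros (∇^ (suc k) f 0) (∇^ (suc (suc k)) f 0) (+ suc k) (+ suc (suc k)))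
  where
  zeros : ∀ a b c d → 0ℤ * a + c * 0ℤ - 0ℤ ≡ 0ℤ * b + d * 0ℤ
  zeros = solve-∀
∇^-scale (suc k) f (suc n) = begin
  ∇^ (suc k) (scale f) (suc n) - ∇^ (suc k) (scale f) n
    ≡⟨ cong₂ _-_ (∇^-scale k f (suc n)) (∇^-scale k f n) ⟩
  + suc n * x + + suc k * w - (+ n * y + + suc k * v)
    ≡⟨ cong₂ (λ m l → m * x + l * w - (+ n * y + l * v)) (ℤ.pos-+ 1 n) (ℤ.pos-+ 1 k) ⟩
  (1ℤ + + n) * x + (1ℤ + + k) * w - (+ n * y + (1ℤ + + k) * v)
    ≡⟨ expand (+ n) (+ k) x y w v ⟩
  (1ℤ + + n) * (x - y) + (y + (1ℤ + + k) * (w - v))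
    -- `w - v` unfolds to `∇ (∇^ k f) n`, which is `y`.
    ≡⟨⟩
  (1ℤ + + n) * (x - y) + (y + (1ℤ + + k) * y)
    ≡⟨ collect (+ n) (+ k) x y ⟩
  (1ℤ + + n) * (x - y) + (1ℤ + (1ℤ + + k)) * y
    ≡⟨ cong₂ (λ m l → m * (x - y) + (1ℤ + l) * y) (ℤ.pos-+ 1 n) (ℤ.pos-+ 1 k) ⟨
  + suc n * (x - y) + (1ℤ + + suc k) * y
    ≡⟨ cong (λ l → + suc n * (x - y) + l * y) (ℤ.pos-+ 1 (suc k)) ⟨
  + suc n * (x - y) + + suc (suc k) * y ∎
  where
  open ≡-Reasoning
  x = ∇^ (suc k) f (suc n)
  y = ∇^ (suc k) f n
  w = ∇^ k f n
  v = shift (∇^ k f) n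
  expand : ∀ n k x y w v → (1ℤ + n) * x + (1ℤ + k) * w - (n * y + (1ℤ + k) * v) ≡
           (1ℤ + n) * (x - y) + (y + (1ℤ + k) * (w - v))
  expand = solve-∀
  collect : ∀ n k x y → (1ℤ + n) * (x - y) + (y + (1ℤ + k) * y) ≡
            (1ℤ + n) * (x - y) + (1ℤ + (1ℤ + k)) * y
  collect = solve-∀

⊛-identityˡ : ∀ f → pow 1-z 0 ⊛ f ≗ f
⊛-identityˡ f n = begin
  1ℤ * f n + ∑[ i < n ] (0ℤ * f (n ∸ suc (toℕ i)))
    ≡⟨ cong₂ _+_ (ℤ.*-identityˡ (f n))
         (trans (sum-cong-≗ {n} λ i → ℤ.*-zeroˡ (f (n ∸ suc (toℕ i)))) (sum-replicate-zero n)) ⟩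
  f n + 0ℤ  ≡⟨ ℤ.+-identityʳ (f n) ⟩
  f n       ∎
  where open ≡-Reasoning

∑-distrib-- : ∀ {n} (f g : Fin n → ℤ) → ∑[ i < n ] (f i - g i) ≡ ∑[ i < n ] f i - ∑[ i < n ] g i
∑-distrib-- {zero}  f g = refl
∑-distrib-- {suc n} f g = trans
  (cong (λ s → f zero - g zero + s) (∑-distrib-- {n} (λ i → f (suc i)) (λ i → g (suc i))))
  (interchange (f zero) (g zero) (∑[ i < n ] f (suc i)) (∑[ i < n ] g (suc i)))
  where
  interchange : ∀ a b c d → a - b + (c - d) ≡ a + c - (b + d)
  interchange = solve-∀

1-z-⊛ : ∀ f → 1-z ⊛ f ≗ ∇ f
1-z-⊛ f zero    = unit (f 0)
  where
  unit : ∀ x → 1ℤ * x + 0ℤ ≡ x - 0ℤ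
  unit = solve-∀
1-z-⊛ f (suc n) = trans (cong (λ s → 1ℤ * f (suc n) + (-1ℤ * f n + s))
    (trans (sum-cong-≗ {n} λ i → ℤ.*-zeroˡ (f (n ∸ suc (toℕ i)))) (sum-replicate-zero n)))
  (unit (f (suc n)) (f n))
  where
  unit : ∀ x y → 1ℤ * x + (-1ℤ * y + 0ℤ) ≡ x - y
  unit = solve-∀

shift-⊛ : ∀ f g → shift f ⊛ g ≗ shift (f ⊛ g)
shift-⊛ f g zero    = trans (ℤ.+-identityʳ _) (ℤ.*-zeroˡ (g 0))
shift-⊛ f g (suc n) = trans (cong (_+ (f ⊛ g) n) (ℤ.*-zeroˡ (g (suc n)))) (ℤ.+-identityˡ _)

∇-⊛ : ∀ f g → ∇ f ⊛ g ≗ ∇ (f ⊛ g)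
∇-⊛ f g n = begin
  (∇ f ⊛ g) n
    ≡⟨ sum-cong-≗ {suc n} (λ i → *-distribʳ-- (f (toℕ i)) (shift f (toℕ i)) (g (n ∸ toℕ i))) ⟩
  ∑[ i < suc n ] (f (toℕ i) * g (n ∸ toℕ i) - shift f (toℕ i) * g (n ∸ toℕ i))
    ≡⟨ ∑-distrib-- {suc n} (λ i → f (toℕ i) * g (n ∸ toℕ i))
         (λ i → shift f (toℕ i) * g (n ∸ toℕ i)) ⟩
  (f ⊛ g) n - (shift f ⊛ g) n  ≡⟨ cong (λ s → (f ⊛ g) n - s) (shift-⊛ f g n) ⟩
  ∇ (f ⊛ g) n ∎
  where
  open ≡-Reasoning
  *-distribʳ-- : ∀ a b c → (a - b) * c ≡ a * c - b * c
  *-distribʳ-- = solve-∀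

⊛-congˡ : ∀ {f g} h → f ≗ g → f ⊛ h ≗ g ⊛ h
⊛-congˡ h f≗g n = sum-cong-≗ {suc n} λ i → cong (_* h (n ∸ toℕ i)) (f≗g (toℕ i))

-- Turns the convolution in `IsHPolynomial` into iterated differences, peeling off one factor 1 - z
-- at a time.
pow-1-z-⊛ : ∀ k f → pow 1-z k ⊛ f ≗ ∇^ k f
pow-1-z-⊛ zero    f n = ⊛-identityˡ f n
pow-1-z-⊛ (suc k) f n = begin
  (pow 1-z (suc k) ⊛ f) n  ≡⟨ ⊛-congˡ f (1-z-⊛ (pow 1-z k)) n ⟩
  (∇ (pow 1-z k) ⊛ f) n    ≡⟨ ∇-⊛ (pow 1-z k) f n ⟩
  ∇ (pow 1-z k ⊛ f) n      ≡⟨ ∇-cong (pow-1-z-⊛ k f) n ⟩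
  ∇^ (suc k) f n           ∎
  where open ≡-Reasoning

-- Nonnegative numerators and decompositions

record Positive (d : ℕ) (h : Series) : Set where
  constructor positive
  field
    nonneg   : ∀ i → 0ℤ ≤ h i
    vanishes : ∀ i → d ℕ.< i → h i ≡ 0ℤ

open Positive

Positive-resp : ∀ {d f g} → f ≗ g → Positive d f → Positive d g
Positive-resp f≗g p .nonneg i       = subst (0ℤ ≤_) (f≗g i) (p .nonneg i)
Positive-resp f≗g p .vanishes i d<i = trans (sym (f≗g i)) (p .vanishes i d<i)

-- Each condition is a decidable statement about a single coefficient. This lets `digraph-positive`
-- distinguish whether a feasible map exists without deciding it.
Positive-stable : ∀ {d h} → ¬ ¬ Positive d h → Positive d h
Positive-stable ¬¬p .nonneg i = decidable-stable (_ ℤ.≤? _) λ ¬q → ¬¬p λ p → ¬q (p .nonneg i)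
Positive-stable ¬¬p .vanishes i d<i =
  decidable-stable (_ ℤ.≟ _) λ ¬q → ¬¬p λ p → ¬q (p .vanishes i d<i)

Positive-0 : ∀ {d f} → f ≗ 0ₛ → Positive d f
Positive-0 f≗0 .nonneg i     = ℤ.≤-reflexive (sym (f≗0 i))
Positive-0 f≗0 .vanishes i _ = f≗0 i

Positive-⊕ : ∀ {d f g} → Positive d f → Positive d g → Positive d (f ⊕ g)
Positive-⊕ p q .nonneg i       = ℤ.+-mono-≤ (p .nonneg i) (q .nonneg i)
Positive-⊕ p q .vanishes i d<i = cong₂ _+_ (p .vanishes i d<i) (q .vanishes i d<i)

Positive-suc : ∀ {d f} → Positive d f → Positive (suc d) f
Positive-suc p .nonneg         = p .nonneg
Positive-suc p .vanishes i d<i = p .vanishes i (ℕ.<-trans (ℕ.n<1+n _) d<i)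

Positive-shift : ∀ {d f} → Positive d f → Positive (suc d) (shift f)
Positive-shift p .nonneg zero             = ℤ.≤-refl
Positive-shift p .nonneg (suc i)          = p .nonneg i
Positive-shift p .vanishes (suc i) (s≤s d<i) = p .vanishes i d<i

-- Σ f(n) zⁿ = h(z) / (1 - z)ᵈ⁺¹ with h of degree at most d and with nonnegative coefficients.
HPositive : ℕ → Series → Set
HPositive d f = Positive d (∇^ (suc d) f)

HPositive-⊕ : ∀ {d f g} → HPositive d f → HPositive d g → HPositive d (f ⊕ g)
HPositive-⊕ {d} {f} {g} p q = Positive-resp (λ n → sym (∇^-⊕ (suc d) f g n)) (Positive-⊕ p q)

HPositive-0 : ∀ {d f} → f ≗ 0ₛ → HPositive d f
HPositive-0 {d} f≗0 = Positive-0 (∇^-0 (suc d) f≗0)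

HPositive-resp : ∀ {d f g} → f ≗ g → HPositive d f → HPositive d g
HPositive-resp {d} f≗g = Positive-resp (∇^-cong (suc d) f≗g)

-- As generating functions in n: (1 - z) T t = z Σ_{s ≥ t} U s + Σ_{s < t} U s, because
-- (1 - z) T 0 = z (T K - T 0) by wrap and start.
module _ {d : ℕ} (K : ℕ) (T U : ℕ → Series)
  (step : ∀ t → T (suc t) ≗ T t ⊕ U t) (U-positive : ∀ t → HPositive d (U t))
  (wrap : ∀ n → T K n ≡ T 0 (suc n)) (start : T 0 0 ≡ 0ℤ) where

  private
    cancel : ∀ x → x - x ≡ 0ℤ
    cancel = solve-∀

  -- Telescoping: the difference is the sum of the `U r` with s ≤ r < m + s.
  difference-positive : ∀ m s → HPositive d (T (m ℕ.+ s) ⊖ T s)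
  difference-positive zero    s = HPositive-0 λ n → cancel (T s n)
  difference-positive (suc m) s = HPositive-resp
    (λ n → sym (trans (cong (λ x → x - T s n) (step (m ℕ.+ s) n))
      (regroup (T (m ℕ.+ s) n) (U (m ℕ.+ s) n) (T s n))))
    (HPositive-⊕ {d} {T (m ℕ.+ s) ⊖ T s} {U (m ℕ.+ s)}
      (difference-positive m s) (U-positive (m ℕ.+ s)))
    where
    regroup : ∀ a b c → a + b - c ≡ a - c + b
    regroup = solve-∀

  staircase-positive : ∀ t → t ℕ.≤ K → HPositive (suc d) (T t)
  -- The factor z raises the degree bound of the upper part to `suc d`; the lower part keeps degree
  -- at most `d`.
  staircase-positive t t≤K = Positive-resp (λ n → sym (expansion n))
    (Positive-⊕ (Positive-shift upper) (Positive-suc lower))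
    where
    lower : HPositive d (T t ⊖ T 0)
    lower = subst (λ s → HPositive d (T s ⊖ T 0)) (ℕ.+-identityʳ t) (difference-positive t 0)
    upper : HPositive d (T K ⊖ T t)
    upper = subst (λ s → HPositive d (T s ⊖ T t)) (ℕ.m∸n+n≡m t≤K) (difference-positive (K ∸ t) t)

    ∇T≗ : ∇ (T t) ≗ shift (T K ⊖ T t) ⊕ (T t ⊖ T 0)
    ∇T≗ zero    = trans (cong (λ x → T t 0 - x) (sym start)) (sym (ℤ.+-identityˡ _))
    ∇T≗ (suc n) = trans (telescope (T t (suc n)) (T t n) (T 0 (suc n)))
      (cong (λ x → x - T t n + (T t (suc n) - T 0 (suc n))) (sym (wrap n)))
      where
      telescope : ∀ a b c → a - b ≡ c - b + (a - c)
      telescope = solve-∀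

    expansion : ∇^ (suc (suc d)) (T t) ≗
                shift (∇^ (suc d) (T K ⊖ T t)) ⊕ ∇^ (suc d) (T t ⊖ T 0)
    expansion n = begin
      ∇^ (suc (suc d)) (T t) n
        ≡⟨ ∇^-∇ (suc d) (T t) n ⟨
      ∇^ (suc d) (∇ (T t)) n
        ≡⟨ ∇^-cong (suc d) ∇T≗ n ⟩
      ∇^ (suc d) (shift (T K ⊖ T t) ⊕ (T t ⊖ T 0)) n
        ≡⟨ ∇^-⊕ (suc d) (shift (T K ⊖ T t)) (T t ⊖ T 0) n ⟩
      ∇^ (suc d) (shift (T K ⊖ T t)) n + ∇^ (suc d) (T t ⊖ T 0) n
        ≡⟨ cong (_+ ∇^ (suc d) (T t ⊖ T 0) n) (∇^-shift (suc d) (T K ⊖ T t) n) ⟩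
      shift (∇^ (suc d) (T K ⊖ T t)) n + ∇^ (suc d) (T t ⊖ T 0) n ∎
      where open ≡-Reasoning

-- The condition f(z) = zᵐ f(1/z) on polynomials of degree at most m. Pairs of indices with sum m
-- avoid truncated subtraction.
record PalindromicSeries (m : ℕ) (f : Series) : Set where
  constructor palindromic
  field
    mirror   : ∀ i j → i ℕ.+ j ≡ m → f i ≡ f j
    vanishes : ∀ i → m ℕ.< i → f i ≡ 0ℤ

open PalindromicSeries

PalindromicSeries-resp : ∀ {m f g} → f ≗ g → PalindromicSeries m g → PalindromicSeries m f
PalindromicSeries-resp f≗g p .mirror i j eq   = trans (f≗g i) (trans (p .mirror i j eq) (sym (f≗g j)))
PalindromicSeries-resp f≗g p .vanishes i m<i = trans (f≗g i) (p .vanishes i m<i)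

palindromic-⊕ : ∀ {m f g} → PalindromicSeries m f → PalindromicSeries m g →
                PalindromicSeries m (f ⊕ g)
palindromic-⊕ p q .mirror i j eq   = cong₂ _+_ (p .mirror i j eq) (q .mirror i j eq)
palindromic-⊕ p q .vanishes i m<i = cong₂ _+_ (p .vanishes i m<i) (q .vanishes i m<i)

palindromic-neg : ∀ {m f} → PalindromicSeries m f → PalindromicSeries m (λ n → - f n)
palindromic-neg p .mirror i j eq   = cong -_ (p .mirror i j eq)
palindromic-neg p .vanishes i m<i = cong -_ (p .vanishes i m<i)

-- zᵐ f(1/z), for f of degree at most m.
reverse : ℕ → Series → Series
reverse m       f zero    = f m
reverse zero    f (suc i) = 0ℤ
reverse (suc m) f (suc i) = reverse m f i

reverse-mirror : ∀ m f i j → i ℕ.+ j ≡ m → reverse m f i ≡ f j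
reverse-mirror m       f zero    j refl = refl
reverse-mirror (suc m) f (suc i) j eq   = reverse-mirror m f i j (ℕ.suc-injective eq)

reverse-vanishes : ∀ m f i → m ℕ.< i → reverse m f i ≡ 0ℤ
reverse-vanishes zero    f (suc i) m<i       = refl
reverse-vanishes (suc m) f (suc i) (s≤s m<i) = reverse-vanishes m f i m<i

reverse-nonneg : ∀ m f → (∀ i → 0ℤ ≤ f i) → ∀ i → 0ℤ ≤ reverse m f i
reverse-nonneg m       f 0≤f zero    = 0≤f m
reverse-nonneg zero    f 0≤f (suc i) = ℤ.≤-refl
reverse-nonneg (suc m) f 0≤f (suc i) = reverse-nonneg m f 0≤f i

-- zᵐ⁺² · z⁻¹ f(1/z) = z · zᵐ f(1/z). At the two ends, the constant term 0 mirrors the coefficient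
-- of f at m + 1, which lies above its degree.
palindromic-shift : ∀ {m f} → PalindromicSeries m f → PalindromicSeries (suc (suc m)) (shift f)
palindromic-shift p .mirror zero    zero    eq = refl
palindromic-shift {m} p .mirror zero (suc j) eq = sym (p .vanishes j
  (ℕ.≤-reflexive (sym (ℕ.suc-injective eq))))
palindromic-shift {m} p .mirror (suc i) zero eq = p .vanishes i
  (ℕ.≤-reflexive (trans (sym (ℕ.suc-injective eq)) (ℕ.+-identityʳ i)))
palindromic-shift {m} p .mirror (suc i) (suc j) eq = p .mirror i j
  (ℕ.suc-injective (trans (sym (ℕ.+-suc i j)) (ℕ.suc-injective eq)))
palindromic-shift p .vanishes (suc i) (s≤s m<i) = p .vanishes i (ℕ.<-trans (ℕ.n<1+n _) m<i)

module _ {d : ℕ} {c : Series} (c-vanishes : ∀ i → d ℕ.< i → c i ≡ 0ℤ) where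

  -- Mirroring in degree d exchanges c* and c.
  palindromic-reverse : PalindromicSeries d (reverse d c ⊕ c)
  palindromic-reverse .mirror i j eq = trans
    (cong₂ _+_ (reverse-mirror d c i j eq) (sym (reverse-mirror d c j i (trans (ℕ.+-comm j i) eq))))
    (ℤ.+-comm (c j) (reverse d c j))
  palindromic-reverse .vanishes i d<i = cong₂ _+_ (reverse-vanishes d c i d<i) (c-vanishes i d<i)

  -- Mirroring in degree d + 1 exchanges c* and zc, because zᵈ⁺¹ c*(1/z) = z c(z).
  palindromic-reverse-shift : PalindromicSeries (suc d) (reverse d c ⊕ shift c)
  palindromic-reverse-shift .mirror zero (suc j) refl = trans (ℤ.+-identityʳ (c j))
    (trans (sym (ℤ.+-identityˡ (c j))) (cong (_+ c j) (sym (reverse-vanishes d c (suc d) (ℕ.n<1+n d)))))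
  palindromic-reverse-shift .mirror (suc i) zero eq = trans
    (cong (_+ c i) (reverse-vanishes d c (suc i) (ℕ.≤-reflexive (cong suc (sym i≡d)))))
    (trans (ℤ.+-identityˡ _) (trans (cong c i≡d) (sym (ℤ.+-identityʳ _))))
    where
    i≡d : i ≡ d
    i≡d = trans (sym (ℕ.+-identityʳ i)) (ℕ.suc-injective eq)
  palindromic-reverse-shift .mirror (suc i) (suc j) eq = trans
    (cong₂ _+_ (reverse-mirror d c (suc i) j si+j≡d) (sym (reverse-mirror d c (suc j) i sj+i≡d)))
    (ℤ.+-comm (c j) _)
    where
    si+j≡d : suc i ℕ.+ j ≡ d
    si+j≡d = trans (sym (ℕ.+-suc i j)) (ℕ.suc-injective eq)
    sj+i≡d : suc j ℕ.+ i ≡ d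
    sj+i≡d = trans (cong suc (ℕ.+-comm j i)) si+j≡d
  palindromic-reverse-shift .vanishes (suc i) (s≤s d<i) = cong₂ _+_
    (reverse-vanishes d c (suc i) (ℕ.<-trans d<i (ℕ.n<1+n i))) (c-vanishes i d<i)

-- The conclusion of the theorem for series; the vanishing conditions inside the mirror fields make
-- `a` and `b` polynomials.
record Decomposition (d : ℕ) (h : Series) : Set where
  field
    a b        : Series
    a-mirror   : PalindromicSeries (suc d) a
    b-mirror   : PalindromicSeries d b
    a-nonpos   : ∀ i → 0ℤ ≤ - a i
    b-nonneg   : ∀ i → 0ℤ ≤ b i
    decomposes : shift h ≗ a ⊕ shift b

open Decomposition

Decomposition-resp : ∀ {d h h′} → h ≗ h′ → Decomposition d h → Decomposition d h′
Decomposition-resp h≗h′ D = record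
  { Decomposition D hiding (decomposes)
  ; decomposes = λ i → trans (sym (shift-cong h≗h′ i)) (D .decomposes i)
  }

Decomposition-0 : ∀ {d h} → h ≗ 0ₛ → Decomposition d h
Decomposition-0 {d} {h} h≗0 = record
  { a          = 0ₛ
  ; b          = 0ₛ
  ; a-mirror   = palindromic (λ _ _ _ → refl) (λ _ _ → refl)
  ; b-mirror   = palindromic (λ _ _ _ → refl) (λ _ _ → refl)
  ; a-nonpos   = λ _ → ℤ.≤-refl
  ; b-nonneg   = λ _ → ℤ.≤-refl
  ; decomposes = λ { zero → refl ; (suc i) → h≗0 i }
  }

-- With c* = zᵈ c(1/z): zh - z(1 - z)c = (a - z(c* + c)) + z(b + (c* + zc)).
Decomposition-⊖∇ : ∀ {d h c} → Decomposition (suc d) h → Positive d c →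
                   Decomposition (suc d) (h ⊖ ∇ c)
Decomposition-⊖∇ {d} {h} {c} D p = record
  { a          = D .a ⊕ (λ i → - shift (reverse d c ⊕ c) i)
  ; b          = D .b ⊕ (reverse d c ⊕ shift c)
  ; a-mirror   = palindromic-⊕ (D .a-mirror)
                   (palindromic-neg (palindromic-shift (palindromic-reverse (p .vanishes))))
  ; b-mirror   = palindromic-⊕ (D .b-mirror) (palindromic-reverse-shift (p .vanishes))
  ; a-nonpos   = λ i → subst (0ℤ ≤_) (neg-distrib (D .a i) (shift (reverse d c ⊕ c) i))
                   (ℤ.+-mono-≤ (D .a-nonpos i) (shift-nonneg i))
  ; b-nonneg   = λ i → ℤ.+-mono-≤ (D .b-nonneg i)
                   (ℤ.+-mono-≤ (reverse-nonneg d c (p .nonneg) i) (Positive-shift p .nonneg i))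
  ; decomposes = λ
      { zero    → trans (D .decomposes zero) (sym (cong (_+ 0ℤ) (ℤ.+-identityʳ (D .a 0))))
      ; (suc i) → trans (cong (λ x → x - ∇ c i) (D .decomposes (suc i)))
                   (regroup (D .a (suc i)) (D .b i) (reverse d c i) (c i) (shift c i))
      }
  }
  where
  neg-distrib : ∀ x y → - x + y ≡ - (x + - y)
  neg-distrib = solve-∀
  regroup : ∀ x y r s t → x + y - (s - t) ≡ x + - (r + s) + (y + (r + t))
  regroup = solve-∀
  shift-nonneg : ∀ i → 0ℤ ≤ shift (reverse d c ⊕ c) i
  shift-nonneg zero    = ℤ.≤-refl
  shift-nonneg (suc i) = ℤ.+-mono-≤ (reverse-nonneg d c (p .nonneg) i) (p .nonneg i)

-- For palindromic h, zh = -h + z(h + h/z).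
Decomposition-palindromic : ∀ {d h} → Positive (suc d) h → PalindromicSeries (suc (suc d)) h →
                            Decomposition (suc d) h
Decomposition-palindromic {d} {h} p s = record
  { a          = λ i → - h i
  ; b          = h ⊕ (λ i → h (suc i))
  ; a-mirror   = palindromic-neg s
  -- For i + j = d + 1 the symmetry of h in degree d + 2 sends index i to j + 1 and i + 1 to j, so
  -- the two summands of `b` change places.
  ; b-mirror   = palindromic
      (λ i j eq → trans (cong₂ _+_
         (s .mirror i (suc j) (trans (ℕ.+-suc i j) (cong suc eq)))
         (s .mirror (suc i) j (cong suc eq))) (ℤ.+-comm (h (suc j)) (h j)))
      (λ i d<i → cong₂ _+_ (p .vanishes i d<i) (p .vanishes (suc i) (ℕ.<-trans d<i (ℕ.n<1+n i))))
  ; a-nonpos   = λ i → subst (0ℤ ≤_) (sym (ℤ.neg-involutive (h i))) (p .nonneg i)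
  ; b-nonneg   = λ i → ℤ.+-mono-≤ (p .nonneg i) (p .nonneg (suc i))
  ; decomposes = λ { zero → cong (λ x → - x + 0ℤ) (sym h0≡0) ; (suc i) → cancel (h i) (h (suc i)) }
  }
  where
  cancel : ∀ x y → x ≡ - y + (x + y)
  cancel = solve-∀
  -- h/z is a polynomial: the constant term of h mirrors the coefficient at d + 2, which lies above
  -- the degree bound d + 1.
  h0≡0 : h 0 ≡ 0ℤ
  h0≡0 = trans (s .mirror 0 (suc (suc d)) refl) (p .vanishes (suc (suc d)) (ℕ.n<1+n (suc d)))

-- Eulerian polynomials

power : ℕ → Series
power zero    _ = 1ℤ
power (suc d)   = scale (power d)

-- The Eulerian polynomial, the numerator of Σ nᵈ zⁿ; the sequence nᵈ arises by applying z d/dz d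
-- times to 1/(1 - z).
eulerian : ℕ → Series
eulerian d = ∇^ (suc d) (power d)

-- The hypothesis is supplied in `chromatic-decomposition`, where nᵈ counts the colourings of the
-- edgeless graph.
module _ (eulerian-positive : ∀ d → Positive d (eulerian d)) where

  -- Induction on `d` by the Eulerian recurrence `expansion`, whose two terms change places when i
  -- and j do. At the ends both coefficients are zero: one through the factor n of `scale`, the
  -- other by the degree bound.
  eulerian-mirror : ∀ d i j → i ℕ.+ j ≡ suc (suc d) → eulerian (suc d) i ≡ eulerian (suc d) j
  eulerian-mirror d zero j eq = begin
    eulerian (suc d) 0
      ≡⟨ ∇^-scale (suc d) (power d) 0 ⟩
    0ℤ * ∇^ (suc (suc d)) (power d) 0 + + suc (suc d) * 0ℤ
      ≡⟨ cong₂ _+_ (ℤ.*-zeroˡ (∇^ (suc (suc d)) (power d) 0)) (ℤ.*-zeroʳ (+ suc (suc d))) ⟩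
    0ℤ
      ≡⟨ eulerian-positive (suc d) .vanishes j (ℕ.≤-reflexive (sym eq)) ⟨
    eulerian (suc d) j ∎
    where open ≡-Reasoning
  eulerian-mirror d (suc i) zero    eq =
    sym (eulerian-mirror d zero (suc i) (trans (sym (ℕ.+-identityʳ (suc i))) eq))
  eulerian-mirror zero (suc zero) (suc zero) eq = refl
  eulerian-mirror zero (suc zero) (suc (suc j)) ()
  eulerian-mirror zero (suc (suc zero)) (suc j) ()
  eulerian-mirror zero (suc (suc (suc i))) (suc j) ()
  eulerian-mirror (suc d) (suc i) (suc j) eq = begin
    eulerian (suc (suc d)) (suc i)
      ≡⟨ expansion i j i+j≡1+d ⟩
    + suc i * e (suc i) + + suc j * e i
      ≡⟨ cong₂ (λ x y → + suc i * x + + suc j * y)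
           (eulerian-mirror d (suc i) j (cong suc i+j≡1+d))
           (eulerian-mirror d i (suc j) (trans (ℕ.+-suc i j) (cong suc i+j≡1+d))) ⟩
    + suc i * e j + + suc j * e (suc j)
      ≡⟨ ℤ.+-comm (+ suc i * e j) _ ⟩
    + suc j * e (suc j) + + suc i * e j
      ≡⟨ expansion j i (trans (ℕ.+-comm j i) i+j≡1+d) ⟨
    eulerian (suc (suc d)) (suc j) ∎
    where
    open ≡-Reasoning
    e : Series
    e = eulerian (suc d)
    i+j≡1+d : i ℕ.+ j ≡ suc d
    i+j≡1+d = ℕ.suc-injective (trans (sym (ℕ.+-suc i j)) (ℕ.suc-injective eq))
    collect : ∀ p q x y → p * (x - y) + (p + q) * y ≡ p * x + q * y
    collect = solve-∀
    expansion : ∀ i j → i ℕ.+ j ≡ suc d →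
                eulerian (suc (suc d)) (suc i) ≡ + suc i * e (suc i) + + suc j * e i
    expansion i j i+j≡1+d = begin
      eulerian (suc (suc d)) (suc i)
        ≡⟨ ∇^-scale (suc (suc d)) (power (suc d)) (suc i) ⟩
      + suc i * (e (suc i) - e i) + + suc (suc (suc d)) * e i
        -- The factor d + 3 coming from `∇^-scale` is (i + 1) + (j + 1).
        ≡⟨ cong (λ n → + suc i * (e (suc i) - e i) + + n * e i)
             (trans (ℕ.+-suc (suc i) j) (cong (λ n → suc (suc n)) i+j≡1+d)) ⟨
      + suc i * (e (suc i) - e i) + + (suc i ℕ.+ suc j) * e i
        ≡⟨ cong (λ n → + suc i * (e (suc i) - e i) + n * e i) (ℤ.pos-+ (suc i) (suc j)) ⟩
      + suc i * (e (suc i) - e i) + (+ suc i + + suc j) * e i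
        ≡⟨ collect (+ suc i) (+ suc j) (e (suc i)) (e i) ⟩
      + suc i * e (suc i) + + suc j * e i ∎

  Decomposition-eulerian : ∀ d → Decomposition d (eulerian d)
  Decomposition-eulerian zero = record
    { a          = 0ₛ
    ; b          = eulerian 0
    ; a-mirror   = palindromic (λ _ _ _ → refl) (λ _ _ → refl)
    ; b-mirror   = palindromic (λ { zero zero _ → refl }) (eulerian-positive 0 .vanishes)
    ; a-nonpos   = λ _ → ℤ.≤-refl
    ; b-nonneg   = eulerian-positive 0 .nonneg
    ; decomposes = λ i → sym (ℤ.+-identityˡ _)
    }
  Decomposition-eulerian (suc d) = Decomposition-palindromic (eulerian-positive (suc d))
    (palindromic (eulerian-mirror d)
      (λ i d<i → eulerian-positive (suc d) .vanishes i (ℕ.<-trans (ℕ.n<1+n (suc d)) d<i)))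

-- Polynomials as series

poly : ℕ → Series → Poly
poly m f = applyUpTo f (suc m)

coeff-applyUpTo : ∀ f m i → i ℕ.< m → coeff (applyUpTo f m) i ≡ f i
coeff-applyUpTo f (suc m) zero    _         = refl
coeff-applyUpTo f (suc m) (suc i) (s≤s i<m) = coeff-applyUpTo (λ n → f (suc n)) m i i<m

coeff-applyUpTo-≥ : ∀ f m i → m ℕ.≤ i → coeff (applyUpTo f m) i ≡ 0ℤ
coeff-applyUpTo-≥ f zero    i       _         = refl
coeff-applyUpTo-≥ f (suc m) (suc i) (s≤s m≤i) = coeff-applyUpTo-≥ (λ n → f (suc n)) m i m≤i

coeff-poly : ∀ {m f} → PalindromicSeries m f → coeff (poly m f) ≗ f
coeff-poly {m} {f} p i with ℕ.≤-<-connex i m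
... | inj₁ i≤m = coeff-applyUpTo f (suc m) i (s≤s i≤m)
... | inj₂ m<i = trans (coeff-applyUpTo-≥ f (suc m) i m<i) (sym (p .vanishes i m<i))

coeff-+ₚ : ∀ p q → coeff (p +ₚ q) ≗ coeff p ⊕ coeff q
coeff-+ₚ []      q       i       = sym (ℤ.+-identityˡ _)
coeff-+ₚ (c ∷ p) []      i       = sym (ℤ.+-identityʳ _)
coeff-+ₚ (c ∷ p) (e ∷ q) zero    = refl
coeff-+ₚ (c ∷ p) (e ∷ q) (suc i) = coeff-+ₚ p q i

coeff--ₚ : ∀ p i → coeff (-ₚ p) i ≡ - coeff p i
coeff--ₚ []      i       = refl
coeff--ₚ (c ∷ p) zero    = refl
coeff--ₚ (c ∷ p) (suc i) = coeff--ₚ p i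

coeff-z· : ∀ p → coeff (z· p) ≗ shift (coeff p)
coeff-z· p zero    = refl
coeff-z· p (suc i) = refl

∸≡suc : ∀ {m n} → m ℕ.< n → n ∸ m ≡ suc (n ∸ suc m)
∸≡suc (s≤s m≤n) = ℕ.+-∸-assoc 1 m≤n

-- The exponents k and m - k lie in the range from 0 to m together. Outside it one of them is
-- negative and the other exceeds m, so both coefficients vanish.
laurent-palindromic : ∀ {m p} → PalindromicSeries m (coeff p) → Palindromic m p
laurent-palindromic {m} {p} s (+ i) with ℕ.≤-<-connex i m
... | inj₁ i≤m = trans (s .mirror i (m ∸ i) (ℕ.m+[n∸m]≡n i≤m)) (cong (laurent p) (sym index))
  where
  index : - (+ i - + m) ≡ + (m ∸ i)
  index = trans (cong -_ (ℤ.m-n≡m⊖n i m)) (trans (sym (ℤ.⊖-swap m i)) (ℤ.⊖-≥ i≤m))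
... | inj₂ m<i = trans (s .vanishes i m<i) (sym (cong (laurent p) index))
  where
  index : - (+ i - + m) ≡ -[1+ i ∸ suc m ]
  index = trans (cong -_ (trans (ℤ.m-n≡m⊖n i m) (ℤ.⊖-≥ (ℕ.<⇒≤ m<i))))
    (cong (λ x → - + x) (∸≡suc m<i))
laurent-palindromic {m} {p} s -[1+ i ] = sym (trans (cong (laurent p) index)
  (s .vanishes _ (s≤s (ℕ.m≤m+n m i))))
  where
  index : - (-[1+ i ] - + m) ≡ + suc (m ℕ.+ i)
  index = trans (ℤ.neg-distrib-+ -[1+ i ] (- + m))
    (trans (cong (λ x → + suc i + x) (ℤ.neg-involutive (+ m))) (cong (λ n → + suc n) (ℕ.+-comm i m)))

decomposition-polynomials : ∀ {d} {h : Poly} → Decomposition d (coeff h) →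
  ∃₂ λ (a b : Poly) →
    (z· h ≈ₚ a +ₚ z· b)
    × Palindromic (suc d) a
    × Palindromic d b
    × NonNegative b
    × NonNegative (-ₚ a)
decomposition-polynomials {d} {h} D = p , q
  , (λ i → trans (coeff-z· h i) (trans (D .decomposes i) (sym (trans (coeff-+ₚ p (z· q) i)
      (cong₂ _+_ (p≗a i) (trans (coeff-z· q i) (shift-cong q≗b i)))))))
  , laurent-palindromic {p = p} (PalindromicSeries-resp p≗a (D .a-mirror))
  , laurent-palindromic {p = q} (PalindromicSeries-resp q≗b (D .b-mirror))
  , (λ i → subst (0ℤ ≤_) (sym (q≗b i)) (D .b-nonneg i))
  , (λ i → subst (0ℤ ≤_) (sym (trans (coeff--ₚ p i) (cong -_ (p≗a i)))) (D .a-nonpos i))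
  where
  p q : Poly
  p = poly (suc d) (D .a)
  q = poly d (D .b)
  p≗a : coeff p ≗ D .a
  p≗a = coeff-poly (D .a-mirror)
  q≗b : coeff q ≗ D .b
  q≗b = coeff-poly (D .b-mirror)

-- Sums over boxes

∑-last : ∀ n (f : ℕ → ℤ) → ∑[ x < suc n ] f (toℕ x) ≡ ∑[ x < n ] f (toℕ x) + f n
∑-last n f = trans (sum-init-last {n} (λ x → f (toℕ x)))
  (cong₂ _+_ (sum-cong-≗ {n} λ x → cong f (Fin.toℕ-inject₁ x)) (cong f (Fin.toℕ-fromℕ n)))

-- Values lie in ℕ rather than in `Fin`, so that one summand serves boxes of every size. Each
-- coordinate has its own bound because `stage` raises them one at a time.
boxSum : ∀ {k} → (Fin k → ℕ) → (Vec ℕ k → ℤ) → ℤ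
boxSum {zero}  b q = q []
boxSum {suc k} b q = ∑[ x < b zero ] boxSum (b ∘ suc) (λ φ → q (toℕ x ∷ φ))

boxSum-cong-bound : ∀ {k} {b c : Fin k → ℕ} q → b ≗ c → boxSum b q ≡ boxSum c q
boxSum-cong-bound {zero}          q b≗c = refl
boxSum-cong-bound {suc k} {b} {c} q b≗c rewrite b≗c zero =
  sum-cong-≗ {c zero} λ x → boxSum-cong-bound (λ φ → q (toℕ x ∷ φ)) (b≗c ∘ suc)

InBox : ∀ {k} → (Fin k → ℕ) → Vec ℕ k → Set
InBox b φ = ∀ i → lookup φ i ℕ.< b i

boxSum-cong : ∀ {k} {b : Fin k → ℕ} {q r} → (∀ φ → InBox b φ → q φ ≡ r φ) → boxSum b q ≡ boxSum b r
boxSum-cong {zero}      q≡r = q≡r [] λ ()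
boxSum-cong {suc k} {b} q≡r = sum-cong-≗ {b zero} λ x → boxSum-cong λ φ φ∈b →
  q≡r (toℕ x ∷ φ) λ { zero → Fin.toℕ<n x ; (suc i) → φ∈b i }

boxSum-+ : ∀ {k} (b : Fin k → ℕ) q r → boxSum b (λ φ → q φ + r φ) ≡ boxSum b q + boxSum b r
boxSum-+ {zero}  b q r = refl
boxSum-+ {suc k} b q r = trans
  (sum-cong-≗ {b zero} λ x → boxSum-+ (b ∘ suc) (λ φ → q (toℕ x ∷ φ)) (λ φ → r (toℕ x ∷ φ)))
  (∑-distrib-+ {b zero} (λ x → boxSum (b ∘ suc) λ φ → q (toℕ x ∷ φ)) _)

boxSum-0 : ∀ {k} (b : Fin k → ℕ) → boxSum b (λ _ → 0ℤ) ≡ 0ℤ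
boxSum-0 {zero}  b = refl
boxSum-0 {suc k} b = trans (sum-cong-≗ {b zero} λ x → boxSum-0 (b ∘ suc)) (sum-replicate-zero (b zero))

boxSum-∑ : ∀ {k} (b : Fin k → ℕ) {m} (q : Fin m → Vec ℕ k → ℤ) →
           boxSum b (λ φ → ∑[ x < m ] q x φ) ≡ ∑[ x < m ] boxSum b (q x)
boxSum-∑ b {zero}  q = boxSum-0 b
boxSum-∑ b {suc m} q = trans (boxSum-+ b (q zero) (λ φ → ∑[ x < m ] q (suc x) φ))
  (cong (λ s → boxSum b (q zero) + s) (boxSum-∑ b (q ∘ suc)))

-- Fubini: coordinate `v` becomes the outermost sum.
boxSum-insertAt : ∀ {k} (b : Fin (suc k) → ℕ) v q →
  boxSum b q ≡ ∑[ x < b v ] boxSum (b ∘ punchIn v) (λ φ → q (insertAt φ v (toℕ x)))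
boxSum-insertAt         b zero    q = refl
boxSum-insertAt {suc k} b (suc v) q = trans
  (sum-cong-≗ {b zero} λ x → boxSum-insertAt (b ∘ suc) v (λ φ → q (toℕ x ∷ φ)))
  (∑-comm {b zero} {b (suc v)} λ x y →
    boxSum (b ∘ suc ∘ punchIn v) (λ φ → q (toℕ x ∷ insertAt φ v (toℕ y))))

-- Indicators of decidable propositions

ind : ∀ {P : Set} → Dec P → ℤ
ind (yes _) = 1ℤ
ind (no _)  = 0ℤ

ind-cong : ∀ {P Q : Set} (P? : Dec P) (Q? : Dec Q) → (P → Q) → (Q → P) → ind P? ≡ ind Q?
ind-cong (yes p) (yes q) f g = refl
ind-cong (yes p) (no ¬q) f g = contradiction (f p) ¬q
ind-cong (no ¬p) (yes q) f g = contradiction (g q) ¬p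
ind-cong (no ¬p) (no ¬q) f g = refl

ind-no : ∀ {P : Set} (P? : Dec P) → ¬ P → ind P? ≡ 0ℤ
ind-no (yes p) ¬p = contradiction p ¬p
ind-no (no _)  ¬p = refl

ind-⊎ : ∀ {P Q R : Set} (P? : Dec P) (Q? : Dec Q) (R? : Dec R) →
        (P → Q ⊎ R) → (Q → P) → (R → P) → (Q → ¬ R) → ind P? ≡ ind Q? + ind R?
ind-⊎ P? (yes q) (yes r) f g h d = contradiction r (d q)
ind-⊎ (yes p) (yes q) (no ¬r) f g h d = refl
ind-⊎ (no ¬p) (yes q) (no ¬r) f g h d = contradiction (g q) ¬p
ind-⊎ (yes p) (no ¬q) (yes r) f g h d = refl
ind-⊎ (no ¬p) (no ¬q) (yes r) f g h d = contradiction (h r) ¬p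
ind-⊎ (yes p) (no ¬q) (no ¬r) f g h d with f p
... | inj₁ q = contradiction q ¬q
... | inj₂ r = contradiction r ¬r
ind-⊎ (no ¬p) (no ¬q) (no ¬r) f g h d = refl

∑-ind-≡ : ∀ {n y} (q : ℕ → ℤ) → y ℕ.< n → ∑[ x < n ] (ind (y ℕ.≟ toℕ x) * q (toℕ x)) ≡ q y
∑-ind-≡ {suc n} {y} q y<1+n with y ℕ.≟ n
... | yes refl = begin
  ∑[ x < suc n ] (ind (n ℕ.≟ toℕ x) * q (toℕ x))
    ≡⟨ ∑-last n (λ x → ind (n ℕ.≟ x) * q x) ⟩
  ∑[ x < n ] (ind (n ℕ.≟ toℕ x) * q (toℕ x)) + ind (n ℕ.≟ n) * q n
    ≡⟨ cong₂ _+_ (trans (sum-cong-≗ {n} λ x → trans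
         (cong (_* q (toℕ x)) (ind-no (n ℕ.≟ toℕ x) (ℕ.<⇒≢ (Fin.toℕ<n x) ∘ sym)))
         (ℤ.*-zeroˡ (q (toℕ x))))
         (sum-replicate-zero n))
         (cong (_* q n) (ind-cong (n ℕ.≟ n) (yes refl) (λ _ → refl {x = n}) (λ _ → refl))) ⟩
  0ℤ + 1ℤ * q n
    ≡⟨ trans (ℤ.+-identityˡ _) (ℤ.*-identityˡ (q n)) ⟩
  q n ∎
  where open ≡-Reasoning
... | no y≢n = begin
  ∑[ x < suc n ] (ind (y ℕ.≟ toℕ x) * q (toℕ x))
    ≡⟨ ∑-last n (λ x → ind (y ℕ.≟ x) * q x) ⟩
  ∑[ x < n ] (ind (y ℕ.≟ toℕ x) * q (toℕ x)) + ind (y ℕ.≟ n) * q n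
    ≡⟨ cong₂ _+_ (∑-ind-≡ {n} q (ℕ.≤∧≢⇒< (ℕ.s≤s⁻¹ y<1+n) y≢n))
         (trans (cong (_* q n) (ind-no (y ℕ.≟ n) y≢n)) (ℤ.*-zeroˡ (q n))) ⟩
  q y + 0ℤ
    ≡⟨ ℤ.+-identityʳ (q y) ⟩
  q y ∎
  where open ≡-Reasoning

-- With the sum over coordinate `v` moved innermost, the indicator leaves the one term where it
-- equals coordinate `u`; that value is in range because all bounds are equal.
boxSum-contract : ∀ {k n} v (u : Fin k) (q : Vec ℕ (suc k) → ℤ) →
  boxSum (const n) (λ φ → ind (lookup φ (punchIn v u) ℕ.≟ lookup φ v) * q φ) ≡
  boxSum (const n) (λ φ → q (insertAt φ v (lookup φ u)))
boxSum-contract {k} {n} v u q = begin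
  boxSum (const n) (λ φ → ind (lookup φ (punchIn v u) ℕ.≟ lookup φ v) * q φ)
    ≡⟨ boxSum-insertAt (const n) v r ⟩
  ∑[ x < n ] boxSum (const n) (λ φ → r (insertAt φ v (toℕ x)))
    ≡⟨ boxSum-∑ (const n) {n} (λ x φ → r (insertAt φ v (toℕ x))) ⟨
  boxSum (const n) (λ φ → ∑[ x < n ] r (insertAt φ v (toℕ x)))
    ≡⟨ boxSum-cong (λ φ φ<n → trans
         (sum-cong-≗ {n} λ x → cong₂ (λ y z → ind (y ℕ.≟ z) * q (insertAt φ v (toℕ x)))
           (insertAt-punchIn φ v (toℕ x) u) (insertAt-lookup φ v (toℕ x)))
         (∑-ind-≡ (λ x → q (insertAt φ v x)) (φ<n u))) ⟩
  boxSum (const n) (λ φ → q (insertAt φ v (lookup φ u))) ∎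
  where
  open ≡-Reasoning
  r : Vec ℕ (suc _) → ℤ
  r φ = ind (lookup φ (punchIn v u) ℕ.≟ lookup φ v) * q φ

-- Strictly increasing maps on an acyclic digraph

Increasing : ∀ {k} → Rel (Fin k) 0ℓ → Vec ℕ k → Set
Increasing D φ = ∀ u v → D u v → lookup φ u ℕ.< lookup φ v

increasing? : ∀ {k} {D : Rel (Fin k) 0ℓ} → Decidable D → ∀ φ → Dec (Increasing D φ)
increasing? D? φ = Fin.all? λ u → Fin.all? λ v → D? u v →-dec (lookup φ u ℕ.<? lookup φ v)

bump : ∀ {P : Set} → ℕ → Dec P → ℕ
bump n (yes _) = suc n
bump n (no  _) = n

bump-yes : ∀ {P : Set} n (P? : Dec P) → P → bump n P? ≡ suc n
bump-yes n (yes _) p = refl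
bump-yes n (no ¬p) p = contradiction p ¬p

bump-no : ∀ {P : Set} n (P? : Dec P) → ¬ P → bump n P? ≡ n
bump-no n (yes p) ¬p = contradiction p ¬p
bump-no n (no _)  ¬p = refl

bump-≤ : ∀ {P : Set} n (P? : Dec P) → bump n P? ℕ.≤ suc n
bump-≤ n (yes _) = ℕ.≤-refl
bump-≤ n (no _)  = ℕ.n≤1+n n

-- `κ i` is the time at which the bound of vertex `i` rises from n to n + 1, so time 0 gives the box
-- with all bounds n.
stage : ∀ {k} → (Fin k → ℕ) → ℕ → ℕ → Fin k → ℕ
stage κ t n i = bump n (κ i ℕ.<? t)

stage-< : ∀ {k} (κ : Fin k → ℕ) {t} n {i} → κ i ℕ.< t → stage κ t n i ≡ suc n
stage-< κ {t} n {i} = bump-yes n (κ i ℕ.<? t)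

stage-≮ : ∀ {k} (κ : Fin k → ℕ) {t} n {i} → ¬ κ i ℕ.< t → stage κ t n i ≡ n
stage-≮ κ {t} n {i} = bump-no n (κ i ℕ.<? t)

stage-suc : ∀ {k} (κ : Fin k → ℕ) t n i → κ i ≢ t → stage κ (suc t) n i ≡ stage κ t n i
stage-suc κ t n i κi≢t with ℕ.<-≤-connex (κ i) t
... | inj₁ κi<t = trans (stage-< κ n (ℕ.m<n⇒m<1+n κi<t)) (sym (stage-< κ n κi<t))
... | inj₂ t≤κi = trans (stage-≮ κ n λ κi<1+t → κi≢t (ℕ.≤-antisym (ℕ.s≤s⁻¹ κi<1+t) t≤κi))
                        (sym (stage-≮ κ n (ℕ.≤⇒≯ t≤κi)))

stage-≤ : ∀ {k} (κ : Fin k → ℕ) t n i → stage κ t n i ℕ.≤ suc n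
stage-≤ κ t n i = bump-≤ n (κ i ℕ.<? t)

staged : ∀ {k} {D : Rel (Fin k) 0ℓ} → (Fin k → ℕ) → Decidable D → ℕ → Series
staged κ D? t n = boxSum (stage κ t n) (λ φ → ind (increasing? D? φ))

-- The passage from time `κ v` to the next: by `κ-inj` only the bound of `v` moves, and by `κ-anti`
-- heads of arcs are raised before their tails.
module Step {k} (κ : Fin (suc k) → ℕ) {D : Rel (Fin (suc k)) 0ℓ} (D? : Decidable D)
  (κ-inj : ∀ {u v} → κ u ≡ κ v → u ≡ v) (κ-anti : ∀ {u v} → D u v → κ v ℕ.< κ u)
  (v : Fin (suc k)) where

  D′ : Rel (Fin k) 0ℓ
  D′ i j = D (punchIn v i) (punchIn v j)

  D′? : Decidable D′
  D′? i j = D? (punchIn v i) (punchIn v j)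

  Sink : Set
  Sink = ∀ w → ¬ D v w

  -- No value exceeds n at this time, so a vertex of value n has no outgoing arc. Conversely, the
  -- tail of an arc into `v` is raised later, still has bound n, and so takes a value below n
  -- automatically.
  added : ∀ n {φ} → InBox (stage (κ ∘ punchIn v) (κ v) n) φ →
          (Increasing D (insertAt φ v n) → Sink × Increasing D′ φ) ×
          (Sink × Increasing D′ φ → Increasing D (insertAt φ v n))
  added n {φ} φ∈ = to , from
    where
    ψ = insertAt φ v n
    ψ-out : ∀ i → lookup ψ (punchIn v i) ≡ lookup φ i
    ψ-out i = insertAt-punchIn φ v n i
    ψv : lookup ψ v ≡ n
    ψv = insertAt-lookup φ v n
    ψ≤n : ∀ w → lookup ψ w ℕ.≤ n
    ψ≤n w with v Fin.≟ w
    ... | yes refl = ℕ.≤-reflexive ψv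
    ... | no v≢w   = subst (λ w → lookup ψ w ℕ.≤ n) (Fin.punchIn-punchOut v≢w)
      (subst (ℕ._≤ n) (sym (ψ-out _))
        (ℕ.s≤s⁻¹ (ℕ.≤-trans (φ∈ _) (stage-≤ (κ ∘ punchIn v) (κ v) n _))))
    to : Increasing D ψ → Sink × Increasing D′ φ
    to inc = (λ w vw → ℕ.<⇒≱ (inc v w vw) (subst (lookup ψ w ℕ.≤_) (sym ψv) (ψ≤n w)))
           , λ i j ij → subst₂ ℕ._<_ (ψ-out i) (ψ-out j) (inc _ _ ij)
    from : Sink × Increasing D′ φ → Increasing D ψ
    from (sink , inc) u w uw with v Fin.≟ u | v Fin.≟ w
    ... | yes refl | _        = contradiction uw (sink w)
    ... | no v≢u   | yes refl = subst₂ (λ u x → lookup ψ u ℕ.< x) (Fin.punchIn-punchOut v≢u) (sym ψv)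
      (subst₂ ℕ._<_ (sym (ψ-out i)) (stage-≮ (κ ∘ punchIn v) n λ κi<κv → ℕ.<-asym κi<κv
         (subst (λ u → κ v ℕ.< κ u) (sym (Fin.punchIn-punchOut v≢u)) (κ-anti uw))) (φ∈ i))
      where i = punchOut v≢u
    ... | no v≢u   | no v≢w   = subst₂ (λ u w → lookup ψ u ℕ.< lookup ψ w)
      (Fin.punchIn-punchOut v≢u) (Fin.punchIn-punchOut v≢w)
      (subst₂ ℕ._<_ (sym (ψ-out _)) (sym (ψ-out _))
        (inc _ _ (subst₂ D (sym (Fin.punchIn-punchOut v≢u)) (sym (Fin.punchIn-punchOut v≢w)) uw)))

  private
    q : Vec ℕ (suc k) → ℤ
    q φ = ind (increasing? D? φ)

  -- The bounds of all other vertices agree before and after the step, so only the slice where `v`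
  -- takes the value n is new.
  staged-added : ∀ n → staged κ D? (suc (κ v)) n ≡ staged κ D? (κ v) n +
    boxSum (stage (κ ∘ punchIn v) (κ v) n) (λ φ → q (insertAt φ v n))
  staged-added n = begin
    staged κ D? (suc (κ v)) n
      ≡⟨ boxSum-insertAt (stage κ (suc (κ v)) n) v q ⟩
    ∑[ x < stage κ (suc (κ v)) n v ] slice (suc (κ v)) (toℕ x)
      ≡⟨ cong (λ m → ∑[ x < m ] slice (suc (κ v)) (toℕ x)) (stage-< κ n (ℕ.n<1+n (κ v))) ⟩
    ∑[ x < suc n ] slice (suc (κ v)) (toℕ x)
      ≡⟨ sum-cong-≗ {suc n} (λ x → boxSum-cong-bound (λ φ → q (insertAt φ v (toℕ x))) λ i →
           stage-suc κ (κ v) n (punchIn v i) λ eq → Fin.punchInᵢ≢i v i (κ-inj eq)) ⟩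
    ∑[ x < suc n ] slice (κ v) (toℕ x)
      ≡⟨ ∑-last n (slice (κ v)) ⟩
    ∑[ x < n ] slice (κ v) (toℕ x) + rest
      ≡⟨ cong (λ m → ∑[ x < m ] slice (κ v) (toℕ x) + rest) (stage-≮ κ n (ℕ.<-irrefl refl)) ⟨
    ∑[ x < stage κ (κ v) n v ] slice (κ v) (toℕ x) + rest
      ≡⟨ cong (_+ rest) (boxSum-insertAt (stage κ (κ v) n) v q) ⟨
    staged κ D? (κ v) n + rest ∎
    where
    open ≡-Reasoning
    slice : ℕ → ℕ → ℤ
    slice t x = boxSum (stage κ t n ∘ punchIn v) (λ φ → q (insertAt φ v x))
    rest : ℤ
    rest = slice (κ v) n

  -- The maps with φ v = n are counted by the graph without v, and exist only if v is a sink.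
  staged-step : HPositive k (staged (κ ∘ punchIn v) D′? (κ v)) →
    ∃ λ U → HPositive k U × staged κ D? (suc (κ v)) ≗ staged κ D? (κ v) ⊕ U
  staged-step pos with Fin.all? (λ w → ¬? (D? v w))
  ... | yes sink = staged (κ ∘ punchIn v) D′? (κ v) , pos , λ n → trans (staged-added n)
    (cong (λ s → staged κ D? (κ v) n + s) (boxSum-cong λ φ φ∈ →
      ind-cong (increasing? D? (insertAt φ v n)) (increasing? D′? φ)
        (λ inc → proj₂ (proj₁ (added n φ∈) inc)) (λ inc → proj₂ (added n φ∈) (sink , inc))))
  ... | no ¬sink = 0ₛ , HPositive-0 (λ _ → refl) , λ n → trans (staged-added n)
    (cong (λ s → staged κ D? (κ v) n + s) (trans (boxSum-cong λ φ φ∈ →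
      ind-no (increasing? D? (insertAt φ v n)) (λ inc → ¬sink (proj₁ (proj₁ (added n φ∈) inc))))
      (boxSum-0 (stage (κ ∘ punchIn v) (κ v) n))))

staged-stationary : ∀ {k} (κ : Fin k → ℕ) {D : Rel (Fin k) 0ℓ} (D? : Decidable D) t →
  (∀ v → κ v ≢ t) → staged κ D? (suc t) ≗ staged κ D? t
staged-stationary κ D? t κ≢t n = boxSum-cong-bound _ λ i → stage-suc κ t n i (κ≢t i)

-- Induction on the number of vertices through `staircase-positive`. All times `t` are covered
-- because deleting `v` leaves the other bounds as they stand at time `κ v`, some raised and some
-- not.
staged-positive : ∀ k (κ : Fin k → ℕ) {D : Rel (Fin k) 0ℓ} (D? : Decidable D) K →
  (∀ {u v} → κ u ≡ κ v → u ≡ v) → (∀ {u v} → D u v → κ v ℕ.< κ u) → (∀ v → κ v ℕ.< K) →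
  ∀ t → t ℕ.≤ K → HPositive k (staged κ D? t)
-- Only the empty map exists, so the count is constantly 1 and its numerator is 1.
staged-positive zero κ D? K κ-inj κ-anti κ<K t t≤K = positive
  (λ { zero → +≤+ z≤n ; (suc n) → ℤ.≤-refl }) (λ { (suc n) _ → refl })
staged-positive (suc k) κ {D} D? K κ-inj κ-anti κ<K =
  staircase-positive K (staged κ D?) (proj₁ ∘ U) (proj₂ ∘ proj₂ ∘ U) (proj₁ ∘ proj₂ ∘ U) wrap
  -- For n = 0 the first vertex has bound 0 at time 0, so the sum is empty.
  (cong (λ m → ∑[ x < m ] boxSum (stage κ 0 0 ∘ suc) (λ φ → ind (increasing? D? (toℕ x ∷ φ))))
    (stage-≮ κ {0} 0 {zero} λ ()))
  where
  U : ∀ t → ∃ λ U → HPositive k U × staged κ D? (suc t) ≗ staged κ D? t ⊕ U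
  U t with Fin.any? (λ v → κ v ℕ.≟ t)
  ... | yes (v , refl) = staged-step (staged-positive k (κ ∘ punchIn v) D′? K
    (Fin.punchIn-injective v _ _ ∘ κ-inj) κ-anti (κ<K ∘ punchIn v) (κ v) (ℕ.<⇒≤ (κ<K v)))
    where open Step κ D? κ-inj κ-anti v
  ... | no ∄v = 0ₛ , HPositive-0 (λ _ → refl) , λ n →
    trans (staged-stationary κ D? t (λ v κv≡t → ∄v (v , κv≡t)) n) (sym (ℤ.+-identityʳ _))
  -- Once every bound n has been raised, the box is the initial one for n + 1.
  wrap : ∀ n → staged κ D? K n ≡ staged κ D? 0 (suc n)
  wrap n = boxSum-cong-bound (λ φ → ind (increasing? D? φ)) λ i →
    trans (stage-< κ n (κ<K i)) (sym (stage-≮ κ {0} (suc n) {i} λ ()))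

-- Chromatic counting functions

-- Loops and repeated edges are allowed, since contraction can create both.
Edges : ℕ → Set
Edges k = List (Fin k × Fin k)

Ascends Differs : ∀ {k} → Vec ℕ k → Fin k × Fin k → Set
Ascends φ (u , v) = lookup φ u ℕ.< lookup φ v
Differs φ (u , v) = lookup φ u ≢ lookup φ v

ascends? : ∀ {k} (φ : Vec ℕ k) → Unary.Decidable (Ascends φ)
ascends? φ (u , v) = lookup φ u ℕ.<? lookup φ v

differs? : ∀ {k} (φ : Vec ℕ k) → Unary.Decidable (Differs φ)
differs? φ (u , v) = ¬? (lookup φ u ℕ.≟ lookup φ v)

-- `C` holds the edges already oriented, `E` those still to be oriented.
mixedCount : ∀ {k} → Edges k → Edges k → Series
mixedCount C E n = boxSum (const n) λ φ → ind (All.all? (ascends? φ) C ×-dec All.all? (differs? φ) E)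

chromatic : ∀ {k} → Edges k → Series
chromatic E n = boxSum (const n) λ φ → ind (All.all? (differs? φ) E)

bounded : ∀ {k} (f : Fin k → ℕ) → ∃ λ K → ∀ i → f i ℕ.≤ K
bounded {zero}  f = 0 , λ ()
bounded {suc k} f = let K , f≤K = bounded (f ∘ suc) in f zero ℕ.⊔ K , λ
  { zero    → ℕ.m≤m⊔n (f zero) K
  ; (suc i) → ℕ.≤-trans (f≤K i) (ℕ.m≤n⊔m (f zero) K)
  }

-- A feasible colouring φ yields the order in which bounds are raised: by decreasing colour, ties broken by index.
module _ {k} (C : Edges k) (φ : Vec ℕ k) (φ-ascends : All (Ascends φ) C) where

  private
    -- In base `k` the index is the last digit and the colour the leading part, so the remainder
    -- recovers the vertex and a larger colour always wins.
    rank : Fin k → ℕ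
    rank u = toℕ u ℕ.+ lookup φ u ℕ.* k

    rank-injective : ∀ {u v} → rank u ≡ rank v → u ≡ v
    rank-injective {u} {v} eq = Fin.toℕ-injective (begin
      toℕ u            ≡⟨ mod u ⟨
      rank u ℕ.% k     ≡⟨ cong (ℕ._% k) eq ⟩
      rank v ℕ.% k     ≡⟨ mod v ⟩
      toℕ v            ∎)
      where
      open ≡-Reasoning
      instance _ = Fin.nonZeroIndex u
      mod : ∀ w → rank w ℕ.% k ≡ toℕ w
      mod w = trans (ℕ.[m+kn]%n≡m%n (toℕ w) (lookup φ w) k) (ℕ.m<n⇒m%n≡m (Fin.toℕ<n w))

    rank-mono : ∀ {u v} → lookup φ u ℕ.< lookup φ v → rank u ℕ.< rank v
    rank-mono {u} {v} φu<φv = begin-strict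
      toℕ u ℕ.+ lookup φ u ℕ.* k  <⟨ ℕ.+-monoˡ-< (lookup φ u ℕ.* k) (Fin.toℕ<n u) ⟩
      suc (lookup φ u) ℕ.* k      ≤⟨ ℕ.*-monoˡ-≤ k φu<φv ⟩
      lookup φ v ℕ.* k            ≤⟨ ℕ.m≤n+m _ (toℕ v) ⟩
      rank v                      ∎
      where open ℕ.≤-Reasoning

    K : ℕ
    K = proj₁ (bounded rank)

    rank≤K : ∀ u → rank u ℕ.≤ K
    rank≤K = proj₂ (bounded rank)

    open DecMembership (≡-dec (Fin._≟_ {k}) (Fin._≟_ {k})) using (_∈?_)

  feasible-positive : HPositive k (mixedCount C [])
  feasible-positive = HPositive-resp
    (λ n → trans (boxSum-cong-bound (λ ψ → ind (increasing? D? ψ)) λ i →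
        stage-≮ (λ u → K ∸ rank u) {0} n {i} λ ())
      (boxSum-cong λ ψ _ → ind-cong (increasing? D? ψ)
        (All.all? (ascends? ψ) C ×-dec All.all? (differs? ψ) [])
        (λ inc → All.tabulate (inc _ _) , [])
        (λ asc u v uv∈C → All.lookup (proj₁ asc) uv∈C)))
    -- Subtracting from `K` reverses the order, so that heads, having larger colours, come first.
    -- All times are at most `K`, hence below `suc K`.
    (staged-positive k (λ u → K ∸ rank u) D? (suc K)
      (λ {u} {v} eq → rank-injective (ℕ.∸-cancelˡ-≡ (rank≤K u) (rank≤K v) eq))
      (λ {u} {v} uv∈C → ℕ.∸-monoʳ-< (rank-mono (All.lookup φ-ascends uv∈C)) (rank≤K v))
      (λ u → s≤s (ℕ.m∸n≤m K (rank u))) 0 z≤n)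
    where
    D? : Decidable (λ u v → (u , v) ∈ C)
    D? u v = (u , v) ∈? C

-- Either some feasible map exists and provides an order of the vertices, or the count is zero, as
-- when `C` contains a cycle.
digraph-positive : ∀ {k} (C : Edges k) → HPositive k (mixedCount C [])
digraph-positive {k} C = Positive-stable λ ¬pos → ¬pos (HPositive-0 λ n →
  trans (boxSum-cong λ φ _ → ind-no (All.all? (ascends? φ) C ×-dec All.all? (differs? φ) [])
    λ asc → ¬pos (feasible-positive C φ (proj₁ asc))) (boxSum-0 {k} (const n)))

mixedCount-orient : ∀ {k} (C : Edges k) u v E →
  mixedCount C ((u , v) ∷ E) ≗ mixedCount ((u , v) ∷ C) E ⊕ mixedCount ((v , u) ∷ C) E
mixedCount-orient C u v E n = trans
  (boxSum-cong λ φ _ → ind-⊎ (All.all? (ascends? φ) C ×-dec All.all? (differs? φ) ((u , v) ∷ E))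
    (All.all? (ascends? φ) ((u , v) ∷ C) ×-dec All.all? (differs? φ) E)
    (All.all? (ascends? φ) ((v , u) ∷ C) ×-dec All.all? (differs? φ) E)
    (orient φ)
    (λ { (u<v ∷ c , e) → c , ℕ.<⇒≢ u<v ∷ e })
    (λ { (v<u ∷ c , e) → c , ℕ.>⇒≢ v<u ∷ e })
    (λ { (u<v ∷ _ , _) (v<u ∷ _ , _) → ℕ.<-asym u<v v<u }))
  (boxSum-+ (const n) (count ((u , v) ∷ C)) (count ((v , u) ∷ C)))
  where
  count : Edges _ → Vec ℕ _ → ℤ
  count C φ = ind (All.all? (ascends? φ) C ×-dec All.all? (differs? φ) E)
  orient : ∀ φ → All (Ascends φ) C × All (Differs φ) ((u , v) ∷ E) →
           All (Ascends φ) ((u , v) ∷ C) × All (Differs φ) E ⊎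
           All (Ascends φ) ((v , u) ∷ C) × All (Differs φ) E
  orient φ (c , u≢v ∷ e) with ℕ.<-cmp (lookup φ u) (lookup φ v)
  ... | tri< u<v _ _ = inj₁ (u<v ∷ c , e)
  ... | tri≈ _ u≡v _ = contradiction u≡v u≢v
  ... | tri> _ _ v<u = inj₂ (v<u ∷ c , e)

mixed-positive : ∀ {k} (C E : Edges k) → HPositive k (mixedCount C E)
mixed-positive C []            = digraph-positive C
mixed-positive C ((u , v) ∷ E) = HPositive-resp (λ n → sym (mixedCount-orient C u v E n))
  (HPositive-⊕ {f = mixedCount ((u , v) ∷ C) E} {g = mixedCount ((v , u) ∷ C) E}
    (mixed-positive ((u , v) ∷ C) E) (mixed-positive ((v , u) ∷ C) E))

chromatic-positive : ∀ {k} (E : Edges k) → HPositive k (chromatic E)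
chromatic-positive E = HPositive-resp
  (λ n → boxSum-cong λ φ _ → ind-cong (All.all? (ascends? φ) [] ×-dec All.all? (differs? φ) E)
    (All.all? (differs? φ) E) proj₂ ([] ,_))
  (mixed-positive [] E)

-- Edgeless graphs, deletion-contraction and the decomposition

∑-const : ∀ n c → ∑[ x < n ] c ≡ + n * c
∑-const zero    c = sym (ℤ.*-zeroˡ c)
∑-const (suc n) c = trans (cong (λ s → c + s) (∑-const n c))
  (trans (factor (+ n) c) (cong (_* c) (sym (ℤ.pos-+ 1 n))))
  where
  factor : ∀ m c → c + m * c ≡ (1ℤ + m) * c
  factor = solve-∀

chromatic-[] : ∀ k → chromatic {k} [] ≗ power k
chromatic-[] zero    n = refl
chromatic-[] (suc k) n = trans (sum-cong-≗ {n} λ _ → chromatic-[] k n) (∑-const n (power k n))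

module Contraction {k} {u v : Fin (suc k)} (v≢u : v ≢ u) where

  merge : Fin (suc k) → Fin k
  merge w with v Fin.≟ w
  ... | yes _  = punchOut v≢u
  ... | no v≢w = punchOut v≢w

  -- Giving `v` the colour of `u` amounts to pulling a colouring of the contracted graph back along
  -- `merge`.
  lookup-merge : ∀ φ w → lookup (insertAt φ v (lookup φ (punchOut v≢u))) w ≡ lookup φ (merge w)
  lookup-merge φ w with v Fin.≟ w
  ... | yes refl = insertAt-lookup φ v (lookup φ (punchOut v≢u))
  ... | no v≢w   = trans (cong (lookup ψ) (sym (Fin.punchIn-punchOut v≢w)))
    (insertAt-punchIn φ v (lookup φ (punchOut v≢u)) (punchOut v≢w))
    where
    ψ : Vec ℕ (suc k)
    ψ = insertAt φ v (lookup φ (punchOut v≢u))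

  contract : Edges (suc k) → Edges k
  contract = map (Product.map merge merge)

  -- A proper colouring for `E` either separates `u` and `v` or gives them the same colour, and in
  -- the second case it factors through `merge`.
  deletion-contraction : ∀ E → chromatic E ≗ chromatic ((u , v) ∷ E) ⊕ chromatic (contract E)
  deletion-contraction E n = begin
    chromatic E n
      ≡⟨ boxSum-cong {b = const n} (λ φ _ → ind-⊎
           (All.all? (differs? φ) E) (All.all? (differs? φ) ((u , v) ∷ E))
           (lookup φ u ℕ.≟ lookup φ v ×-dec All.all? (differs? φ) E)
           (split φ) (λ { (_ ∷ e) → e }) proj₂ (λ { (u≢v ∷ _) (u≡v , _) → u≢v u≡v })) ⟩
    boxSum (const n) (λ φ → q₁ φ + q₂ φ)
      ≡⟨ boxSum-+ (const n) q₁ q₂ ⟩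
    chromatic ((u , v) ∷ E) n + boxSum (const n) q₂
      ≡⟨ cong (λ s → chromatic ((u , v) ∷ E) n + s) contracted ⟩
    chromatic ((u , v) ∷ E) n + chromatic (contract E) n ∎
    where
    open ≡-Reasoning
    q q₁ q₂ : Vec ℕ (suc k) → ℤ
    q  φ = ind (All.all? (differs? φ) E)
    q₁ φ = ind (All.all? (differs? φ) ((u , v) ∷ E))
    q₂ φ = ind (lookup φ u ℕ.≟ lookup φ v ×-dec All.all? (differs? φ) E)
    split : ∀ φ → All (Differs φ) E →
            All (Differs φ) ((u , v) ∷ E) ⊎ (lookup φ u ≡ lookup φ v × All (Differs φ) E)
    split φ e with lookup φ u ℕ.≟ lookup φ v
    ... | yes u≡v = inj₂ (u≡v , e)
    ... | no u≢v  = inj₁ (u≢v ∷ e)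
    ind-× : ∀ {P Q : Set} (P? : Dec P) (Q? : Dec Q) → ind (P? ×-dec Q?) ≡ ind P? * ind Q?
    ind-× (yes p) (yes q) = refl
    ind-× (yes p) (no ¬q) = refl
    ind-× (no ¬p) (yes q) = refl
    ind-× (no ¬p) (no ¬q) = refl
    extend : Vec ℕ k → Vec ℕ (suc k)
    extend φ = insertAt φ v (lookup φ (punchOut v≢u))
    contracted : boxSum (const n) q₂ ≡ chromatic (contract E) n
    contracted = begin
      boxSum (const n) q₂
        ≡⟨ boxSum-cong {b = const n} (λ φ _ → trans
             (ind-× (lookup φ u ℕ.≟ lookup φ v) (All.all? (differs? φ) E))
             (cong (λ w → ind (lookup φ w ℕ.≟ lookup φ v) * q φ) (sym (Fin.punchIn-punchOut v≢u)))) ⟩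
      boxSum (const n) (λ φ → ind (lookup φ (punchIn v (punchOut v≢u)) ℕ.≟ lookup φ v) * q φ)
        ≡⟨ boxSum-contract v (punchOut v≢u) q ⟩
      boxSum (const n) (λ φ → q (extend φ))
        ≡⟨ boxSum-cong (λ φ _ → ind-cong
             (All.all? (differs? (extend φ)) E) (All.all? (differs? φ) (contract E))
             (λ es → All.map⁺ (All.map (λ {e} →
               subst₂ _≢_ (lookup-merge φ (proj₁ e)) (lookup-merge φ (proj₂ e))) es))
             (λ es → All.map (λ {e} →
               subst₂ _≢_ (sym (lookup-merge φ (proj₁ e))) (sym (lookup-merge φ (proj₂ e))))
               (All.map⁻ es))) ⟩
      chromatic (contract E) n ∎

chromatic-loop : ∀ {k} (u : Fin k) E → chromatic ((u , u) ∷ E) ≗ 0ₛ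
chromatic-loop {k} u E n = trans
  (boxSum-cong λ φ _ → ind-no (All.all? (differs? φ) ((u , u) ∷ E)) λ { (u≢u ∷ _) → u≢u refl })
  (boxSum-0 {k} (const n))

-- Induction on the edge list: the deletion contributes its decomposition, the contraction its
-- nonnegative numerator.
chromatic-decomposition : ∀ {k} (E : Edges k) → Decomposition k (∇^ (suc k) (chromatic E))
chromatic-decomposition {k} [] = Decomposition-resp (λ n → sym (∇^-cong (suc k) (chromatic-[] k) n))
  (Decomposition-eulerian (λ d → HPositive-resp (chromatic-[] d) (chromatic-positive [])) k)
chromatic-decomposition {k} ((u , v) ∷ E) with v Fin.≟ u
... | yes refl = Decomposition-0 (∇^-0 (suc k) (chromatic-loop u E))
chromatic-decomposition {suc k} ((u , v) ∷ E) | no v≢u = Decomposition-resp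
  (λ n → sym (trans (∇^-cong (suc (suc k)) deletion n)
    (∇^-⊖ (suc (suc k)) (chromatic E) (chromatic (contract E)) n)))
  -- The contraction has one vertex fewer, so one more difference is applied to its count than its
  -- own numerator c takes; this is the `∇ c` subtracted here.
  (Decomposition-⊖∇ (chromatic-decomposition E) (chromatic-positive (contract E)))
  where
  open Contraction v≢u
  deletion : chromatic ((u , v) ∷ E) ≗ chromatic E ⊖ chromatic (contract E)
  deletion n = sym (trans (cong (λ s → s - chromatic (contract E) n) (deletion-contraction E n))
    (cancel (chromatic ((u , v) ∷ E) n) (chromatic (contract E) n)))
    where
    cancel : ∀ x y → x + y - y ≡ x
    cancel = solve-∀

-- From counting indices of maps to sums over boxes

∑-++ : ∀ m n (f : Fin (m ℕ.+ n) → ℤ) →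
       ∑[ i < m ℕ.+ n ] f i ≡ ∑[ x < m ] f (x ↑ˡ n) + ∑[ y < n ] f (m ↑ʳ y)
∑-++ zero    n f = sym (ℤ.+-identityˡ _)
∑-++ (suc m) n f = trans (cong (λ s → f zero + s) (∑-++ m n (f ∘ suc))) (sym (ℤ.+-assoc (f zero) _ _))

∑-combine : ∀ m n (f : Fin (m ℕ.* n) → ℤ) →
            ∑[ i < m ℕ.* n ] f i ≡ ∑[ x < m ] ∑[ y < n ] f (combine x y)
∑-combine zero    n f = refl
∑-combine (suc m) n f = trans (∑-++ n (m ℕ.* n) f)
  (cong (λ s → ∑[ y < n ] f (y ↑ˡ (m ℕ.* n)) + s) (∑-combine m n (λ i → f (n ↑ʳ i))))

-- `finToFun` reads off base n digits, and `combine x y` puts the digit x before those of y. The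
-- hypothesis relates `f` and `q` through values only, since one takes an index and the other a
-- vector.
∑-finToFun : ∀ d n (f : Fin (n ℕ.^ d) → ℤ) (q : Vec ℕ d → ℤ) →
  (∀ i φ → (∀ j → toℕ (finToFun i j) ≡ lookup φ j) → f i ≡ q φ) →
  ∑[ i < n ℕ.^ d ] f i ≡ boxSum (const n) q
∑-finToFun zero    n f q f≡q = trans (ℤ.+-identityʳ (f zero)) (f≡q zero [] λ ())
∑-finToFun (suc d) n f q f≡q = trans (∑-combine n (n ℕ.^ d) f) (sum-cong-≗ {n} λ x →
  ∑-finToFun d n (λ y → f (combine x y)) (λ φ → q (toℕ x ∷ φ)) λ y φ y≡φ →
    f≡q (combine x y) (toℕ x ∷ φ) λ
    { zero    → cong (toℕ ∘ proj₁) (Fin.remQuot-combine {n} x y)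
    ; (suc j) → trans (cong (λ p → toℕ (finToFun {n} {d} (proj₂ p) j))
                  (Fin.remQuot-combine {n} x y)) (y≡φ j)
    })

length-filter-tabulate : ∀ {A : Set} {P : Pred A 0ℓ} (P? : Unary.Decidable P) {m} (f : Fin m → A) →
  + length (filter P? (tabulate f)) ≡ ∑[ i < m ] ind (P? (f i))
length-filter-tabulate P? {zero}  f = refl
length-filter-tabulate P? {suc m} f with P? (f zero)
... | yes _ = trans (ℤ.pos-+ 1 _) (cong (λ s → 1ℤ + s) (length-filter-tabulate P? (f ∘ suc)))
... | no _  = trans (length-filter-tabulate P? (f ∘ suc)) (sym (ℤ.+-identityˡ _))

module _ {d} (G : SimpleGraph d) where
  open SimpleGraph G using (adj?)

  -- Each edge is listed in both directions, which imposes the same condition twice.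
  edges : Edges d
  edges = filter (λ (u , v) → adj? u v) (cartesianProduct (allFin d) (allFin d))

  χ≗chromatic : ∀ n → + χ G n ≡ chromatic edges n
  χ≗chromatic n = trans (length-filter-tabulate (λ i → proper? G (finToFun {n} {d} i)) id)
    (∑-finToFun d n (λ i → ind (proper? G (finToFun {n} {d} i)))
      (λ φ → ind (All.all? (differs? φ) edges)) λ i φ i≡φ →
      ind-cong (proper? G (finToFun {n} {d} i)) (All.all? (differs? φ) edges)
        (λ proper → All.tabulate λ {(u , v)} uv∈E φu≡φv →
          proper u v (proj₂ (∈-filter⁻ (λ (u , v) → adj? u v)
            {xs = cartesianProduct (allFin d) (allFin d)} uv∈E))
            (Fin.toℕ-injective (trans (i≡φ u) (trans φu≡φv (sym (i≡φ v))))))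
        (λ differs u v uv iu≡iv → All.lookup differs
          (∈-filter⁺ (λ (u , v) → adj? u v) (∈-cartesianProduct⁺ (∈-allFin u) (∈-allFin v)) uv)
          (trans (sym (i≡φ u)) (trans (cong toℕ iu≡iv) (i≡φ v)))))

theorem1p3 : ∀ (d : ℕ) (G : SimpleGraph d) (h : Poly) → IsHPolynomial G h →
    ∃₂ λ (a b : Poly) →
    (z· h ≈ₚ a +ₚ z· b)
    × Palindromic (suc d) a
    × Palindromic d b
    × NonNegative b
    × NonNegative (-ₚ a)
theorem1p3 d G h isH = decomposition-polynomials (Decomposition-resp ∇χ≗h (chromatic-decomposition (edges G)))
  where
  ∇χ≗h : ∇^ (suc d) (chromatic (edges G)) ≗ coeff h
  ∇χ≗h n = trans (sym (trans (pow-1-z-⊛ (suc d) (λ m → + χ G m) n)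
    (∇^-cong (suc d) (χ≗chromatic G) n))) (isH n)
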